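{- Let $G$ be a connected graph which has no clique cutsets and no universal vertices. Then $G$ is $(C_4,\text{hammer})$-free if and only if $G$ has girth at least $5$; and $G$ is $(C_4,\text{bull})$-free if and only if $G$ is a clique blowup of some graph of girth at least $5$.
   Context: All graphs are finite and simple. For graphs $H_1,\dots,H_t$, a graph $G$ is $(H_1,\dots,H_t)$-free if no induced subgraph of $G$ is isomorphic to any $H_i$. $C_4$ is the cycle on 4 vertices. A bull is the 5-vertex graph consisting of a triangle with two disjoint pendant edges (i.e. pendant edges attached at two distinct vertices of the triangle). A hammer is the 5-vertex graph obtained by identifying an endvertex of a path on 3 vertices with a vertex of a triangle. A clique is a set of mutually adjacent vertices. A clique cutset of $G$ is a clique $K$ in $G$ such that $G-K$ has more components than $G$. A universal vertex of $G$ is a vertex $v$ adjacent to all vertices of $V(G)\setminus\{v\}$. The girth of $G$ is the length of a shortest cycle in $G$ (infinite if $G$ has no cycle). Blowing up a vertex $v$ of a graph into a (possibly empty) clique $K$ means replacing $v$ by the complete graph on $K$, with every vertex of $K$ made adjacent to all neighbors of $v$ (and to no other vertices outside $K$). A clique blowup of a graph $H$ is a graph obtained from $H$ by blowing up all the vertices of $H$ into cliques, where each of these cliques is allowed to be empty. -}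

module Defs where

open import Data.Fin using (Fin; zero; suc; toℕ; _≟_; #_)
open import Data.Fin.Subset using (Subset; inside; outside; _∈_; ∁; ∣_∣)
open import Data.List using (List; []; _∷_)
open import Data.List.Relation.Unary.All using (All; all?; lookup)
import Data.List.Membership.DecPropositional as DecMembership
open import Data.Nat using (ℕ; _≤_; _<_)
open import Data.Product using (Σ-syntax; ∃-syntax; _×_; _,_)
open import Data.Product.Properties using (≡-dec)
open import Data.Sum using (_⊎_; inj₁; inj₂; swap)
open import Data.Vec using ([]; _∷_)
open import Function using (_↔_; Inverse; _⇔_; Injective; Surjective; _on_)
open import Level using (0ℓ)
open import Relation.Binary using (Rel; Symmetric; Irreflexive; Decidable)
open import Relation.Binary.Construct.Closure.ReflexiveTransitive using (Star)
open import Relation.Binary.PropositionalEquality using (_≡_; _≢_; refl)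
open import Relation.Nullary using (¬_; ¬?; _⊎-dec_)
open import Relation.Nullary.Decidable using (True; toWitness)

record Graph : Set₁ where
  infix 4 _~_ _~?_
  field
    order  : ℕ
    _~_    : Rel (Fin order) 0ℓ
    ~-sym  : Symmetric _~_
    ~-irr  : Irreflexive _≡_ _~_
    _~?_   : Decidable _~_

  V : Set
  V = Fin order

open Graph public using (V; order)

RelIso : {A B : Set} → Rel A 0ℓ → Rel B 0ℓ → Set
RelIso {A} {B} R S =
  Σ[ f ∈ A ↔ B ] (∀ x y → R x y ⇔ S (Inverse.to f x) (Inverse.to f y))

infix 4 _≅_
_≅_ : Graph → Graph → Set
G ≅ H = RelIso (Graph._~_ G) (Graph._~_ H)

-- The increasing enumeration of the elements of a subset.
element : ∀ {n} (S : Subset n) → Fin ∣ S ∣ → Fin n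
element (inside  ∷ S) zero    = zero
element (inside  ∷ S) (suc i) = suc (element S i)
element (outside ∷ S) i       = suc (element S i)

-- The subgraph of G induced by S; vertex i of it is the i-th element of S.
infix 8 _[_] _∖_
_[_] : (G : Graph) → Subset (order G) → Graph
G [ S ] = record
  { order = ∣ S ∣
  ; _~_   = _~_ on element S
  ; ~-sym = ~-sym
  ; ~-irr = λ { refl → ~-irr refl }
  ; _~?_  = λ i j → element S i ~? element S j
  } where open Graph G

_∖_ : (G : Graph) → Subset (order G) → Graph
G ∖ K = G [ ∁ K ]

infix 4 _-free
_-free : List Graph → Graph → Set₁
(Hs -free) G = All (λ H → ¬ (∃[ S ] G [ S ] ≅ H)) Hs

-- The implicit argument certifies that no listed edge is a loop.
fromEdges : ∀ n (es : List (Fin n × Fin n)) →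
            {True (all? (λ (u , v) → ¬? (u ≟ v)) es)} → Graph
fromEdges n es {noLoops} = record
  { order = n
  ; _~_   = λ u v → (u , v) ∈ₗ es ⊎ (v , u) ∈ₗ es
  ; ~-sym = swap
  ; ~-irr = λ { refl (inj₁ e) → lookup (toWitness noLoops) e refl
              ; refl (inj₂ e) → lookup (toWitness noLoops) e refl }
  ; _~?_  = λ u v → ((u , v) ∈? es) ⊎-dec ((v , u) ∈? es)
  } where open DecMembership (≡-dec (_≟_ {n}) _≟_)
            using (_∈?_) renaming (_∈_ to _∈ₗ_)

C₄ : Graph
C₄ = fromEdges 4
  ((# 0 , # 1) ∷ (# 1 , # 2) ∷ (# 2 , # 3) ∷ (# 3 , # 0) ∷ [])

-- Triangle 0 1 2, with pendant edges 0 3 and 1 4.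
bull : Graph
bull = fromEdges 5
  ((# 0 , # 1) ∷ (# 1 , # 2) ∷ (# 2 , # 0) ∷ (# 0 , # 3) ∷ (# 1 , # 4) ∷ [])

-- Triangle 0 1 2 and path 2 3 4, sharing the vertex 2.
hammer : Graph
hammer = fromEdges 5
  ((# 0 , # 1) ∷ (# 1 , # 2) ∷ (# 2 , # 0) ∷ (# 2 , # 3) ∷ (# 3 , # 4) ∷ [])

module _ (G : Graph) where
  open Graph G using (_~_)

  Joined : Rel (V G) 0ℓ
  Joined = Star _~_

  Connected : Set
  Connected = ∀ u v → Joined u v

  -- G has exactly c components: they can be labelled by Fin c, each label
  -- being used, so that two vertices get the same label iff they are joined.
  ComponentCount : ℕ → Set
  ComponentCount c =
    Σ[ label ∈ (V G → Fin c) ]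
      Surjective _≡_ _≡_ label × (∀ u v → label u ≡ label v ⇔ Joined u v)

  IsClique : Subset (order G) → Set
  IsClique K = ∀ u v → u ∈ K → v ∈ K → u ≢ v → u ~ v

  IsUniversal : V G → Set
  IsUniversal v = ∀ u → u ≢ v → v ~ u

IsCliqueCutset : (G : Graph) → Subset (order G) → Set
IsCliqueCutset G K =
  IsClique G K ×
  (∃[ c ] ∃[ d ] ComponentCount G c × ComponentCount (G ∖ K) d × c < d)

-- j follows i in the cyclic order 0, 1, …, ℓ - 1, 0 on Fin ℓ.
CyclicNext : ∀ {ℓ} → Rel (Fin ℓ) 0ℓ
CyclicNext {ℓ} i j =
  toℕ j ≡ ℕ.suc (toℕ i) ⊎ (ℕ.suc (toℕ i) ≡ ℓ × toℕ j ≡ 0)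

-- Cycles are not required to be induced.
record Cycle (G : Graph) (ℓ : ℕ) : Set where
  open Graph G using (_~_)
  field
    3≤ℓ      : 3 ≤ ℓ
    vertex   : Fin ℓ → V G
    distinct : Injective _≡_ _≡_ vertex
    adjacent : ∀ i j → CyclicNext i j → vertex i ~ vertex j

HasGirth : Graph → ℕ → Set
HasGirth G g = Cycle G g × (∀ m → Cycle G m → g ≤ m)

-- A graph without cycles has infinite girth: HasGirth G g then holds for no g,
-- and the condition is satisfied for every k.
GirthAtLeast : ℕ → Graph → Set
GirthAtLeast k G = ∀ g → HasGirth G g → k ≤ g

-- Adjacency in the graph obtained from H by replacing each vertex v by a
-- clique of size k v, possibly 0.
BlowupAdj : (H : Graph) (k : V H → ℕ) → Rel (Σ[ v ∈ V H ] Fin (k v)) 0ℓ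
BlowupAdj H k x@(u , _) y@(v , _) = Graph._~_ H u v ⊎ (u ≡ v × x ≢ y)

IsCliqueBlowupOf : Graph → Graph → Set
IsCliqueBlowupOf G H = ∃[ k ] RelIso (Graph._~_ G) (BlowupAdj H k)

{-# OPTIONS --safe #-}
module Submission where

-- Let v be any vertex. Since v is not universal, the non-neighbours of v contain a component E,
-- and N(E) is not a clique: there are non-adjacent x, y in N(v), both with neighbours in E.
-- By C₄-freeness the common neighbours of x and y form a clique, so deleting them leaves G
-- connected. If a common neighbour r ≠ v of x and y also sees neighbours of x and of y in E, then
-- in both the hammer-free and the bull-free case no walk avoiding the common neighbours leaves
-- N(r), which makes r universal.
--
-- In the hammer-free case a triangle through v produces such an r. In the bull-free case a common
-- neighbour r ≠ v that sees a neighbour of x in E also sees a neighbour of y in E; so no r does, and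
-- then all common neighbours of x and y are twins of v. Hence x and y lie in different components
-- of the subgraph of N(v) induced by the non-twins of v. By bull-freeness each such component is
-- then a module of G, by the absence of clique cutsets it is a clique, and so its vertices are
-- twins. Thus every triangle contains a pair of twins, and identifying twins gives girth at least 5.

open import Defs
open import Data.Empty using (⊥; ⊥-elim)
open import Data.Fin using (Fin; zero; suc; _≟_; #_)
open import Data.Fin.Properties
  using (any?; all?; ¬∀⟶∃¬; suc-injective; sequence; toℕ-injective; toℕ<n)
open import Data.Fin.Subset using (Subset; inside; outside; _∈_; ∁; ∣_∣)
open import Data.Fin.Subset.Properties using (x∈∁p⇒x∉p; x∉p⇒x∈∁p)
open import Data.List using (List; []; _∷_)
import Data.List.Membership.DecPropositional as DecMembership
open import Data.List.Membership.Propositional renaming (_∈_ to _∈ₗ_)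
open import Data.List.Relation.Unary.All as All using (All; []; _∷_)
open import Data.Nat using (ℕ; zero; suc; _≤_; _<_; z≤n; s≤s)
open import Data.Nat.Properties using (<-irrefl)
open import Data.Product using (Σ-syntax; ∃-syntax; _×_; _,_; proj₁; proj₂)
open import Data.Product.Properties using (≡-dec)
open import Data.Sum using (_⊎_; inj₁; inj₂)
open import Data.Vec using (Vec; []; _∷_; lookup; tabulate; here; there)
open import Data.Vec.Properties using (lookup∘tabulate; []=⇒lookup; lookup⇒[]=)
import Data.Vec.Relation.Unary.All as VecAll
import Data.Vec.Relation.Unary.AllPairs as AllPairs
open import Data.Vec.Relation.Unary.Unique.Propositional using (Unique)
open import Data.Vec.Relation.Unary.Unique.Propositional.Properties using (lookup-injective)
open import Effect.Monad using (RawMonad)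
open import Function using (_⇔_; _∘_; id; _on_; Inverse; Equivalence; mk⇔; mk↔ₛ′; Injective; Surjective)
open import Level using (0ℓ)
open import Relation.Binary using (Rel; Decidable; IsEquivalence)
open import Relation.Binary.Construct.Closure.ReflexiveTransitive
  using (Star; ε; _◅_; _◅◅_; reverse)
open import Relation.Binary.PropositionalEquality
  using (_≡_; _≢_; refl; sym; trans; cong; subst; subst₂)
open import Relation.Nullary
  using (¬_; Dec; yes; no; does; contradiction; ¬?; _×-dec_; _⊎-dec_; _→-dec_)
open import Relation.Nullary.Decidable
  using (True; False; toWitness; toWitnessFalse; decidable-stable; ¬¬-excluded-middle; dec-true)
open import Relation.Nullary.Negation using (¬¬-Monad)

-- Finite sets

-- Double negation commutes with quantification over a finite set. So while `⊥` is being proved, a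
-- separating clique given as an arbitrary predicate may be turned into a `Subset`.
¬¬-decidable : ∀ {n} (P : Fin n → Set) → ¬ ¬ (∀ i → Dec (P i))
¬¬-decidable P = sequence (RawMonad.rawApplicative ¬¬-Monad) (λ _ → ¬¬-excluded-middle)

¬¬-decidable₂ : ∀ {n} (R : Rel (Fin n) 0ℓ) → ¬ ¬ Decidable R
¬¬-decidable₂ R = sequence (RawMonad.rawApplicative ¬¬-Monad) (λ i → ¬¬-decidable (R i))

element-∈ : ∀ {n} (S : Subset n) i → element S i ∈ S
element-∈ (inside  ∷ S) zero    = here
element-∈ (inside  ∷ S) (suc i) = there (element-∈ S i)
element-∈ (outside ∷ S) i       = there (element-∈ S i)

element-injective : ∀ {n} (S : Subset n) → Injective _≡_ _≡_ (element S)
element-injective (inside  ∷ S) {zero}  {zero}  eq = refl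
element-injective (inside  ∷ S) {suc i} {suc j} eq = cong suc (element-injective S (suc-injective eq))
element-injective (outside ∷ S) eq = element-injective S (suc-injective eq)

index : ∀ {n} {S : Subset n} {v} → v ∈ S → ∃[ i ] element S i ≡ v
index {S = inside ∷ S} here = zero , refl
index {S = inside ∷ S} (there v∈S) = let i , eq = index v∈S in suc i , cong suc eq
index {S = outside ∷ S} (there v∈S) = let i , eq = index v∈S in i , cong suc eq

module _ {n} {P : Fin n → Set} (P? : ∀ v → Dec (P v)) where

  subset : Subset n
  subset = tabulate (does ∘ P?)

  ∈-subset⁺ : ∀ {v} → P v → v ∈ subset
  ∈-subset⁺ {v} Pv =
    lookup⇒[]= v subset (trans (lookup∘tabulate (does ∘ P?) v) (dec-true (P? v) Pv))

  ∈-subset⁻ : ∀ {v} → v ∈ subset → P v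
  ∈-subset⁻ {v} v∈ with P? v | trans (sym (lookup∘tabulate (does ∘ P?) v)) ([]=⇒lookup v∈)
  ... | yes Pv | _ = Pv

Classifies : ∀ {n d} → Rel (Fin n) 0ℓ → (Fin n → Fin d) → Set
Classifies _≈_ label = Surjective _≡_ _≡_ label × (∀ u v → label u ≡ label v ⇔ u ≈ v)

-- Induction on `n`: `zero` shares the label of a later equivalent element, or gets a fresh label if
-- there is none. Both components and twin classes are labelled this way.
classify : ∀ {n} {_≈_ : Rel (Fin n) 0ℓ} → IsEquivalence _≈_ → Decidable _≈_ →
  ∃[ d ] Σ[ label ∈ (Fin n → Fin d) ] Classifies _≈_ label
classify {zero} _ _ = 0 , (λ ()) , (λ ()) , λ ()
classify {suc n} {_≈_} eqv _≈?_ with classify {n} {_≈_ on suc} eqv-suc (λ u v → suc u ≈? suc v)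
  where
  open IsEquivalence eqv renaming (refl to ≈-refl; sym to ≈-sym; trans to ≈-trans)
  eqv-suc : IsEquivalence (_≈_ on suc)
  eqv-suc = record { refl = ≈-refl ; sym = ≈-sym ; trans = ≈-trans }
... | d , label , surj , classes with any? (λ i → zero ≈? suc i)
... | yes (i , 0≈i) = d , label′ , surj′ , classes′
  where
  open IsEquivalence eqv renaming (refl to ≈-refl; sym to ≈-sym; trans to ≈-trans)
  label′ : Fin (suc n) → Fin d
  label′ zero    = label i
  label′ (suc v) = label v
  surj′ : Surjective _≡_ _≡_ label′
  surj′ c = let v , eq = surj c in suc v , λ { refl → eq refl }
  classes′ : ∀ u v → label′ u ≡ label′ v ⇔ u ≈ v
  classes′ zero    zero    = mk⇔ (λ _ → ≈-refl) (λ _ → refl)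
  classes′ zero    (suc v) = mk⇔ (λ eq → ≈-trans 0≈i (Equivalence.to (classes i v) eq))
                                 (λ 0≈v → Equivalence.from (classes i v) (≈-trans (≈-sym 0≈i) 0≈v))
  classes′ (suc u) zero    = mk⇔ (λ eq → ≈-trans (Equivalence.to (classes u i) eq) (≈-sym 0≈i))
                                 (λ u≈0 → Equivalence.from (classes u i) (≈-trans u≈0 0≈i))
  classes′ (suc u) (suc v) = classes u v
... | no 0≉ = suc d , label′ , surj′ , classes′
  where
  open IsEquivalence eqv renaming (refl to ≈-refl; sym to ≈-sym; trans to ≈-trans)
  label′ : Fin (suc n) → Fin (suc d)
  label′ zero    = zero
  label′ (suc v) = suc (label v)
  surj′ : Surjective _≡_ _≡_ label′
  surj′ zero    = zero , λ { refl → refl }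
  surj′ (suc c) = let v , eq = surj c in suc v , λ { refl → cong suc (eq refl) }
  classes′ : ∀ u v → label′ u ≡ label′ v ⇔ u ≈ v
  classes′ zero    zero    = mk⇔ (λ _ → ≈-refl) (λ _ → refl)
  classes′ zero    (suc v) = mk⇔ (λ ()) (λ 0≈v → contradiction (v , 0≈v) 0≉)
  classes′ (suc u) zero    = mk⇔ (λ ()) (λ u≈0 → contradiction (u , ≈-sym u≈0) 0≉)
  classes′ (suc u) (suc v) = mk⇔ (Equivalence.to (classes u v) ∘ suc-injective)
                                 (cong suc ∘ Equivalence.from (classes u v))

distinct⇒1< : ∀ {d} {i j : Fin d} → i ≢ j → 1 < d
distinct⇒1< {1} {zero} {zero} i≢j = contradiction refl i≢j
distinct⇒1< {suc (suc _)} _ = s≤s (s≤s z≤n)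

-- Induced subgraphs

Embedding : Graph → Graph → Set
Embedding H G = Σ[ f ∈ (V H → V G) ] Injective _≡_ _≡_ f ×
  (∀ i j → Graph._~_ G (f i) (f j) ⇔ Graph._~_ H i j)

embedding⇒induced : ∀ {H G} → Embedding H G → ∃[ S ] G [ S ] ≅ H
embedding⇒induced {H} {G} (f , inj , adj) = S , mk↔ₛ′ to from to∘from from∘to , respects
  where
  image? : ∀ v → Dec (∃[ i ] f i ≡ v)
  image? v = any? (λ i → f i ≟ v)
  S : Subset (order G)
  S = subset image?
  preimage : ∀ i → ∃[ j ] f j ≡ element S i
  preimage i = ∈-subset⁻ image? (element-∈ S i)
  to : Fin ∣ S ∣ → V H
  to = proj₁ ∘ preimage
  position : ∀ j → ∃[ i ] element S i ≡ f j
  position j = index (∈-subset⁺ image? (j , refl))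
  from : V H → Fin ∣ S ∣
  from = proj₁ ∘ position
  to∘from : ∀ j → to (from j) ≡ j
  to∘from j = inj (trans (proj₂ (preimage (from j))) (proj₂ (position j)))
  from∘to : ∀ i → from (to i) ≡ i
  from∘to i = element-injective S (trans (proj₂ (position (to i))) (proj₂ (preimage i)))
  respects : ∀ i j → Graph._~_ G (element S i) (element S j) ⇔ Graph._~_ H (to i) (to j)
  respects i j = subst₂ (λ u v → Graph._~_ G u v ⇔ Graph._~_ H (to i) (to j))
    (proj₂ (preimage i)) (proj₂ (preimage j)) (adj (to i) (to j))

induced⇒embedding : ∀ {H G} → ∃[ S ] G [ S ] ≅ H → Embedding H G
induced⇒embedding {H} {G} (S , iso , respects) =
  element S ∘ from , inj ∘ element-injective S , adj
  where
  open Inverse iso using (to; from; strictlyInverseˡ)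
  inj : Injective _≡_ _≡_ from
  inj {i} {j} eq = trans (sym (strictlyInverseˡ i)) (trans (cong to eq) (strictlyInverseˡ j))
  adj : ∀ i j → Graph._~_ G (element S (from i)) (element S (from j)) ⇔ Graph._~_ H i j
  adj i j = subst₂ (λ u v → Graph._~_ G (element S (from i)) (element S (from j)) ⇔ Graph._~_ H u v)
    (strictlyInverseˡ i) (strictlyInverseˡ j) (respects (from i) (from j))

module _ {n : ℕ} where
  Listed : List (Fin n × Fin n) → Rel (Fin n) 0ℓ
  Listed xs i j = (i , j) ∈ₗ xs ⊎ (j , i) ∈ₗ xs

module _ {n : ℕ} (es ns : List (Fin n × Fin n)) where
  open DecMembership (≡-dec (_≟_ {n}) (_≟_ {n})) using (_∈?_)

  covered? : ∀ i j → Dec (i ≡ j ⊎ (Listed es i j ⊎ Listed ns i j))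
  covered? i j = (i ≟ j) ⊎-dec
    ((((i , j) ∈? es) ⊎-dec ((j , i) ∈? es)) ⊎-dec (((i , j) ∈? ns) ⊎-dec ((j , i) ∈? ns)))

  Exhaustive : Set
  Exhaustive = True (all? λ i → all? (covered? i))

-- Evaluation checks that `es` and `ns` cover all pairs, so the listed facts settle every adjacency.
-- They also give injectivity, because adjacent vertices are distinct and each non-edge comes with
-- an inequality.
pattern-embedding : ∀ {n} (es : List (Fin n × Fin n)) {noLoops} (ns : List (Fin n × Fin n)) →
  {Exhaustive es ns} → (G : Graph) (f : Fin n → V G) →
  All (λ (i , j) → Graph._~_ G (f i) (f j)) es →
  All (λ (i , j) → f i ≢ f j × ¬ Graph._~_ G (f i) (f j)) ns →
  Embedding (fromEdges n es {noLoops}) G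
pattern-embedding {n} es {noLoops} ns {exhaustive} G f edges nonedges = f , inj , adj
  where
  open Graph G hiding (V; order)
  H = fromEdges n es {noLoops}
  edge : ∀ {i j} → Graph._~_ H i j → f i ~ f j
  edge (inj₁ ij∈es) = All.lookup edges ij∈es
  edge (inj₂ ji∈es) = ~-sym (All.lookup edges ji∈es)
  nonedge : ∀ {i j} → Listed ns i j → f i ≢ f j × ¬ f i ~ f j
  nonedge (inj₁ ij∈ns) = All.lookup nonedges ij∈ns
  nonedge (inj₂ ji∈ns) = let ≢ , ≁ = All.lookup nonedges ji∈ns in ≢ ∘ sym , ≁ ∘ ~-sym
  inj : Injective _≡_ _≡_ f
  inj {i} {j} eq with toWitness exhaustive i j
  ... | inj₁ i≡j = i≡j
  ... | inj₂ (inj₁ e) = contradiction (edge e) (~-irr eq)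
  ... | inj₂ (inj₂ e) = contradiction eq (proj₁ (nonedge e))
  adj : ∀ i j → f i ~ f j ⇔ Graph._~_ H i j
  adj i j with toWitness exhaustive i j
  ... | inj₁ refl = mk⇔ (λ e → contradiction e (~-irr refl)) (λ e → contradiction e (Graph.~-irr H refl))
  ... | inj₂ (inj₁ e) = mk⇔ (λ _ → e) edge
  ... | inj₂ (inj₂ e) = mk⇔ (λ e′ → contradiction e′ (proj₂ (nonedge e)))
                            (λ e′ → contradiction (edge e′) (proj₂ (nonedge e)))

module _ (G : Graph) where
  open Graph G hiding (V; order)

  C₄-Free : Set
  C₄-Free = ∀ {a b c d} → a ~ b → b ~ c → c ~ d → d ~ a →
    a ≢ c → ¬ a ~ c → b ≢ d → ¬ b ~ d → ⊥

  -- The adjacencies and non-adjacencies of a bull or a hammer force its vertices to be distinct, by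
  -- `separated-by`. Opposite vertices of a 4-cycle have the same neighbours, which is why `C₄-Free`
  -- carries inequalities.
  Bull-Free : Set
  Bull-Free = ∀ {a b c p q} → a ~ b → b ~ c → c ~ a → a ~ p → b ~ q →
    ¬ p ~ b → ¬ p ~ c → ¬ q ~ a → ¬ q ~ c → ¬ p ~ q → ⊥

  Hammer-Free : Set
  Hammer-Free = ∀ {a b c p q} → a ~ b → b ~ c → c ~ a → c ~ p → p ~ q →
    ¬ p ~ a → ¬ p ~ b → ¬ q ~ a → ¬ q ~ b → ¬ q ~ c → ⊥

  separated-by : ∀ {u v w} → u ~ w → ¬ v ~ w → v ≢ u
  separated-by u~w v≁w refl = v≁w u~w

  C₄-free⁺ : ¬ (∃[ S ] G [ S ] ≅ C₄) → C₄-Free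
  C₄-free⁺ free {a} {b} {c} {d} ab bc cd da a≢c a≁c b≢d b≁d =
    free (embedding⇒induced {C₄} {G} (pattern-embedding _ ((# 0 , # 2) ∷ (# 1 , # 3) ∷ []) G
      (lookup (a ∷ b ∷ c ∷ d ∷ []))
      (ab ∷ bc ∷ cd ∷ da ∷ []) ((a≢c , a≁c) ∷ (b≢d , b≁d) ∷ [])))

  bull-free⁺ : ¬ (∃[ S ] G [ S ] ≅ bull) → Bull-Free
  bull-free⁺ free {a} {b} {c} {p} {q} ab bc ca ap bq p≁b p≁c q≁a q≁c p≁q =
    free (embedding⇒induced {bull} {G} (pattern-embedding _
      ((# 3 , # 1) ∷ (# 3 , # 2) ∷ (# 4 , # 0) ∷ (# 4 , # 2) ∷ (# 3 , # 4) ∷ []) G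
      (lookup (a ∷ b ∷ c ∷ p ∷ q ∷ []))
      (ab ∷ bc ∷ ca ∷ ap ∷ bq ∷ [])
      ((separated-by bc p≁c , p≁b) ∷ (separated-by (~-sym bc) p≁b , p≁c) ∷
       (separated-by (~-sym ca) q≁c , q≁a) ∷ (separated-by ca q≁a , q≁c) ∷
       (separated-by (~-sym bq) p≁b , p≁q) ∷ [])))

  hammer-free⁺ : ¬ (∃[ S ] G [ S ] ≅ hammer) → Hammer-Free
  hammer-free⁺ free {a} {b} {c} {p} {q} ab bc ca cp pq p≁a p≁b q≁a q≁b q≁c =
    free (embedding⇒induced {hammer} {G} (pattern-embedding _
      ((# 3 , # 0) ∷ (# 3 , # 1) ∷ (# 4 , # 0) ∷ (# 4 , # 1) ∷ (# 4 , # 2) ∷ []) G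
      (lookup (a ∷ b ∷ c ∷ p ∷ q ∷ []))
      (ab ∷ bc ∷ ca ∷ cp ∷ pq ∷ [])
      ((separated-by ab p≁b , p≁a) ∷ (separated-by (~-sym ab) p≁a , p≁b) ∷
       (separated-by ab q≁b , q≁a) ∷ (separated-by (~-sym ab) q≁a , q≁b) ∷
       (separated-by ca q≁a , q≁c) ∷ [])))

-- Clique separators and detours

module _ (G : Graph) where
  open Graph G hiding (V; order)

  Clique : (V G → Set) → Set
  Clique K = ∀ {u w} → K u → K w → u ≢ w → u ~ w

  -- A walk avoiding a clique is represented by the invariants it preserves.
  Unseparated : Set₁
  Unseparated = ∀ (K I : V G → Set) → Clique K →
    (∀ {u w} → I u → ¬ K u → u ~ w → ¬ K w → ¬ ¬ I w) →
    ∀ {a b} → ¬ K a → ¬ K b → I a → ¬ ¬ I b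

  -- If `I` failed at `b`, no walk of `G ∖ K` could lead from `a` to `b`. Then `G ∖ K` would have at
  -- least two components against the single one of `G`.
  no-cutset⇒unseparated : Connected G → ¬ (∃[ K ] IsCliqueCutset G K) → Unseparated
  no-cutset⇒unseparated connected no-cutset K I clique step {a} {b} a∉K b∉K Ia b∉I =
    ¬¬-decidable K λ K? → ¬¬-decidable₂ (Joined (G ∖ subset K?)) (cut K?)
    where
    cut : (K? : ∀ v → Dec (K v)) → ¬ Decidable (Joined (G ∖ subset K?))
    cut K? joined? = no-cutset (S , S-clique , 1 , d , one-component , (label , surj , classes) , 1<d)
      where
      S = subset K?
      S-clique : IsClique G S
      S-clique u w u∈S w∈S = clique (∈-subset⁻ K? u∈S) (∈-subset⁻ K? w∈S)
      vertex : V (G ∖ S) → V G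
      vertex = element (∁ S)
      vertex∉K : ∀ i → ¬ K (vertex i)
      vertex∉K i Kv = x∈∁p⇒x∉p (element-∈ (∁ S) i) (∈-subset⁺ K? Kv)
      locate : ∀ {v} → ¬ K v → ∃[ i ] vertex i ≡ v
      locate v∉K = index (x∉p⇒x∈∁p (v∉K ∘ ∈-subset⁻ K?))
      follow : ∀ {i j} → Joined (G ∖ S) i j → I (vertex i) → ¬ ¬ I (vertex j)
      follow ε Ii ¬Ii = ¬Ii Ii
      follow {i} (_◅_ {j = k} i~k walk) Ii j∉I =
        step Ii (vertex∉K i) i~k (vertex∉K k) λ Ik → follow walk Ik j∉I
      classification = classify
        record { refl = ε ; sym = reverse ~-sym ; trans = _◅◅_ } joined?
      d = proj₁ classification
      label = proj₁ (proj₂ classification)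
      surj = proj₁ (proj₂ (proj₂ classification))
      classes = proj₂ (proj₂ (proj₂ classification))
      1<d : 1 < d
      -- Equal labels would give a walk outside `K` carrying `I` from `a` to `b`.
      1<d with i , refl ← locate a∉K | j , refl ← locate b∉K =
        distinct⇒1< λ eq → follow (Equivalence.to (classes i j) eq) Ia b∉I
      one-component : ComponentCount G 1
      one-component = (λ _ → zero) , (λ { zero → a , λ _ → refl }) ,
        λ u v → mk⇔ (λ _ → connected u v) (λ _ → refl)

  -- Connectedness as an induction principle: later arguments choose a property `Q` and check it
  -- along single edges inside `E`, without handling walks.
  ConnectedSet : (V G → Set) → Set₁
  ConnectedSet E = ∀ (Q : V G → Set) → (∀ {u w} → E u → E w → u ~ w → Q u → Q w) →
    ∀ {a b} → E a → E b → Q a → Q b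

  StepIn : (V G → Set) → Rel (V G) 0ℓ
  StepIn P u w = P u × u ~ w × P w

  Component : (V G → Set) → V G → V G → Set
  Component P a u = P u × Star (StepIn P) a u

  component-step : ∀ {P a u w} → Component P a u → u ~ w → P w → Component P a w
  component-step (Pu , path) u~w Pw = Pw , path ◅◅ ((Pu , u~w , Pw) ◅ ε)

  component-connected : ∀ {P a} → ConnectedSet (Component P a)
  component-connected {P} {a} Q step (Pb , a↝b) (Pc , a↝c) =
    follow (Pb , a↝b) (reverse (λ (Pu , u~w , Pw) → Pw , ~-sym u~w , Pu) a↝b ◅◅ a↝c)
    where
    follow : ∀ {u w} → Component P a u → Star (StepIn P) u w → Q u → Q w
    follow u∈ ε Qu = Qu
    follow u∈ ((Pu , u~k , Pk) ◅ walk) Qu = follow k∈ walk (step u∈ k∈ u~k Qu)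
      where k∈ = component-step u∈ u~k Pk

  -- A coarse hole through v: its part beyond x and y is the whole connected set E.
  record Detour (v x y : V G) (E : V G → Set) : Set₁ where
    field
      connected : ConnectedSet E
      avoids    : ∀ {e} → E e → e ≢ v × ¬ v ~ e
      v~x       : v ~ x
      v~y       : v ~ y
      x≢y       : x ≢ y
      x≁y       : ¬ x ~ y
      {xₑ yₑ}   : V G
      xₑ∈E      : E xₑ
      yₑ∈E      : E yₑ
      xₑ~x      : xₑ ~ x
      yₑ~y      : yₑ ~ y

  Closed : Rel (V G) 0ℓ
  Closed u w = w ≡ u ⊎ u ~ w

  -- Equality of closed neighbourhoods, so distinct twins are adjacent ("true twins").
  Twins : Rel (V G) 0ℓ
  Twins u v = ∀ w → (Closed u w → Closed v w) × (Closed v w → Closed u w)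

  closed? : Decidable Closed
  closed? u w = (w ≟ u) ⊎-dec (u ~? w)

  twins? : Decidable Twins
  twins? u v = all? λ w →
    (closed? u w →-dec closed? v w) ×-dec (closed? v w →-dec closed? u w)

  twins-equivalence : IsEquivalence Twins
  twins-equivalence = record
    { refl  = λ _ → id , id
    ; sym   = λ t w → let to , from = t w in from , to
    ; trans = λ s t w → proj₁ (t w) ∘ proj₁ (s w) , proj₂ (s w) ∘ proj₂ (t w)
    }

-- Detours in C₄-free graphs

module Theory (G : Graph) (c4 : C₄-Free G) (unseparated : Unseparated G)
  (no-universal : ¬ (∃[ v ] IsUniversal G v)) where
  open Graph G hiding (V; order)

  stable : ∀ {u w} → ¬ ¬ u ~ w → u ~ w
  stable {u} {w} = decidable-stable (u ~? w)

  ≁-sym : ∀ {u w} → ¬ u ~ w → ¬ w ~ u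
  ≁-sym u≁w = u≁w ∘ ~-sym

  differ : ∀ {u v w} → u ~ w → ¬ v ~ w → v ≢ u
  differ = separated-by G

  far : ∀ v → ∃[ w ] w ≢ v × ¬ v ~ w
  far v with ¬∀⟶∃¬ (order G) _ (λ u → ¬? (u ≟ v) →-dec (v ~? u)) (λ univ → no-universal (v , univ))
  ... | w , ¬w = w , (λ w≡v → ¬w (contradiction w≡v)) , λ v~w → ¬w (λ _ → v~w)

  -- If every detour is refuted, the attachment `K` of the component `E` is a clique, since two
  -- non-adjacent vertices of `K` would be the ends of a detour. But `K` separates `z` in `E` from
  -- `v`.
  detour : ∀ v → (∀ {x y E} → Detour G v x y E → ⊥) → ⊥
  detour v k = unseparated K E K-clique step z∉K v∉K (Mz , ε) λ (Mv , _) → proj₁ Mv refl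
    where
    M : V G → Set
    M w = w ≢ v × ¬ v ~ w
    z = proj₁ (far v)
    Mz = proj₂ (far v)
    E = Component G M z
    K : V G → Set
    K w = v ~ w × ∃[ e ] E e × e ~ w
    K-clique : Clique G K
    K-clique (v~u , e , e∈E , e~u) (v~w , f , f∈E , f~w) u≢w = stable λ u≁w → k record
      { connected = component-connected G ; avoids = proj₁
      ; v~x = v~u ; v~y = v~w ; x≢y = u≢w ; x≁y = u≁w
      ; xₑ∈E = e∈E ; yₑ∈E = f∈E ; xₑ~x = e~u ; yₑ~y = f~w }
    z∉K : ¬ K z
    z∉K (v~z , _) = proj₂ Mz v~z
    v∉K : ¬ K v
    v∉K (v~v , _) = ~-irr refl v~v
    -- A neighbour `w` of `E` outside `K` cannot see `v`, so it belongs to `M` and is absorbed by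
    -- the component.
    step : ∀ {u w} → E u → ¬ K u → u ~ w → ¬ K w → ¬ ¬ E w
    step {u} {w} u∈E _ u~w w∉K w∉E = w∉E (component-step G u∈E u~w (w≢v , v≁w))
      where
      v≁w : ¬ v ~ w
      v≁w v~w = w∉K (v~w , u , u∈E , u~w)
      w≢v : w ≢ v
      w≢v refl = proj₂ (proj₁ u∈E) (~-sym u~w)

  detour-swap : ∀ {v x y E} → Detour G v x y E → Detour G v y x E
  detour-swap D = record
    { connected = connected ; avoids = avoids
    ; v~x = v~y ; v~y = v~x ; x≢y = x≢y ∘ sym ; x≁y = ≁-sym x≁y
    ; xₑ∈E = yₑ∈E ; yₑ∈E = xₑ∈E ; xₑ~x = yₑ~y ; yₑ~y = xₑ~x }
    where open Detour D

  -- Two non-adjacent common neighbours would form an induced 4-cycle with `x` and `y`.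
  common-clique : ∀ {x y} → x ≢ y → ¬ x ~ y → Clique G (λ z → z ~ x × z ~ y)
  common-clique x≢y x≁y (u~x , u~y) (w~x , w~y) u≢w =
    stable λ u≁w → c4 u~x (~-sym w~x) w~y (~-sym u~y) u≢w u≁w x≢y x≁y

  module DetourProperties {v x y E} (D : Detour G v x y E) where
    open Detour D public

    v≁ : ∀ {e} → E e → ¬ v ~ e
    v≁ e∈E = proj₂ (avoids e∈E)

    ≁v : ∀ {e} → E e → ¬ e ~ v
    ≁v e∈E = ≁-sym (v≁ e∈E)

    not-both : ∀ {e} → E e → e ~ x → ¬ e ~ y
    not-both e∈E e~x e~y = c4 v~x (~-sym e~x) e~y (~-sym v~y)
      (proj₁ (avoids e∈E) ∘ sym) (v≁ e∈E) x≢y x≁y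

    Common : V G → Set
    Common z = z ~ x × z ~ y

    Common-clique : Clique G Common
    Common-clique = common-clique x≢y x≁y

    x∉Common : ¬ Common x
    x∉Common (x~x , _) = ~-irr refl x~x

    -- Common is a clique, so its complement is connected.
    hub-spreads : ∀ {r} (I : V G → Set) → Common r → I x → (∀ {u} → I u → r ~ u) →
      (∀ {u w} → I u → ¬ Common u → u ~ w → ¬ Common w → ¬ ¬ I w) → ⊥
    hub-spreads {r} I r∈ Ix I⇒~ step =
      unseparated Common I Common-clique step x∉Common w∉ Ix (r≁w ∘ I⇒~)
      where
      w = proj₁ (far r)
      r≁w = proj₂ (proj₂ (far r))
      w∉ : ¬ Common w
      w∉ w∈ = r≁w (Common-clique r∈ w∈ (proj₁ (proj₂ (far r)) ∘ sym))

  -- The hammer-free case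

  module HammerCase (hammer-free : Hammer-Free G) where

    -- The triangle `v`, `s`, `t` and the path `v`, `a`, `f` would form a hammer; an edge from `f`
    -- to `s` or `t` would close an induced 4-cycle with `a` and `v`. So a vertex `a` of N(v) with a
    -- neighbour outside N[v] sees an end of each edge within N(v).
    boundary-covers : ∀ {v a f s t} → v ~ a → a ~ f → f ≢ v → ¬ v ~ f →
      v ~ s → v ~ t → s ~ t → ¬ a ~ s → ¬ a ~ t → ⊥
    boundary-covers {v} {a} {f} v~a a~f f≢v v≁f v~s v~t s~t a≁s a≁t =
      hammer-free s~t (~-sym v~t) v~s v~a a~f a≁s a≁t
        (off v~s (differ s~t a≁t) a≁s) (off v~t (differ (~-sym s~t) a≁s) a≁t) (≁-sym v≁f)
      where
      off : ∀ {s} → v ~ s → a ≢ s → ¬ a ~ s → ¬ f ~ s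
      off v~s a≢s a≁s f~s = c4 (~-sym a~f) (~-sym v~a) v~s (~-sym f~s) f≢v (≁-sym v≁f) a≢s a≁s

    module _ {v x y E} (D : Detour G v x y E) where
      open DetourProperties D

      -- The vertex `y` has the neighbour `yₑ` outside N[v], so it sees an end of the edge between
      -- `s` and `x`, and that end is not `x`.
      extend : ∀ {s} → v ~ s → s ~ x → s ~ y
      extend v~s s~x = stable λ s≁y → boundary-covers v~y (~-sym yₑ~y)
        (proj₁ (avoids yₑ∈E)) (v≁ yₑ∈E) v~s v~x s~x (≁-sym s≁y) (≁-sym x≁y)

      -- Likewise `x` sees an end of the edge between `b` and `c`, and `extend` makes that end
      -- adjacent to `y`.
      hub : ∀ {b c} → v ~ b → v ~ c → b ~ c → ∃[ r ] v ~ r × Common r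
      hub {b} {c} v~b v~c b~c with b ~? x | c ~? x
      ... | yes b~x | _       = b , v~b , b~x , extend v~b b~x
      ... | no _    | yes c~x = c , v~c , c~x , extend v~c c~x
      ... | no b≁x  | no c≁x  = ⊥-elim (boundary-covers v~x (~-sym xₑ~x)
        (proj₁ (avoids xₑ∈E)) (v≁ xₑ∈E) v~b v~c b~c (≁-sym b≁x) (≁-sym c≁x))

      module _ {r} (v~r : v ~ r) (r∈ : Common r) where

        -- Otherwise the triangle `v`, `z`, `r` with the path `r`, `u`, `w` is a hammer, where an
        -- edge from `w` to `z` would give the 4-cycle `w`, `z`, `r`, `u`. Since `u` misses `x` or
        -- `y`, one of them can serve as `z`.
        spoke-step : ∀ {z u w} → v ~ z → r ~ z → E u → E w → u ~ w → ¬ u ~ z → u ~ r → w ~ r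
        spoke-step v~z r~z u∈E w∈E u~w u≁z u~r = stable λ w≁r →
          hammer-free v~z (~-sym r~z) (~-sym v~r) (~-sym u~r) u~w (≁v u∈E) u≁z (≁v w∈E)
            (λ w~z → c4 w~z (~-sym r~z) (~-sym u~r) u~w (differ (~-sym v~r) (≁v w∈E)) w≁r
              (differ (~-sym v~z) (≁v u∈E) ∘ sym) (≁-sym u≁z))
            w≁r

        spokes-connected : ∀ {u w} → E u → E w → u ~ w → u ~ r → w ~ r
        spokes-connected {u} u∈E w∈E u~w u~r with u ~? x
        ... | no u≁x  = spoke-step v~x (proj₁ r∈) u∈E w∈E u~w u≁x u~r
        ... | yes u~x = spoke-step v~y (proj₂ r∈) u∈E w∈E u~w (not-both u∈E u~x) u~r

        -- Without spokes, hammers on the triangle `v`, `r`, `x` with a path from `x` into `E` would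
        -- spread adjacency to `x` from `xₑ` over `E` to `yₑ`.
        spoke-exists : ¬ (∀ {e} → E e → ¬ e ~ r)
        spoke-exists none = not-both yₑ∈E (connected (_~ x)
          (λ u∈E w∈E u~w u~x → stable λ w≁x →
            hammer-free v~r (proj₁ r∈) (~-sym v~x) (~-sym u~x) u~w
              (≁v u∈E) (none u∈E) (≁v w∈E) (none w∈E) w≁x)
          xₑ∈E yₑ∈E xₑ~x) yₑ~y

        complete : ∀ {e} → E e → r ~ e
        complete e∈E = stable λ r≁e → spoke-exists λ u∈E u~r →
          r≁e (~-sym (connected (_~ r) spokes-connected u∈E e∈E u~r))

    module _ {v x y E} (D : Detour G v x y E) {r} (v~r : v ~ r) where
      open DetourProperties D

      -- By `boundary-covers` at `r`, the vertex `u` sees an end of each edge within N(r). If `u`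
      -- missed `x`, it would see both `v` and `xₑ`, giving the induced 4-cycle `u`, `v`, `x`, `xₑ`.
      exits-through-x : Common r → ∀ {u f} → r ~ u → u ~ f → f ≢ r → ¬ r ~ f → ¬ ¬ u ~ x
      exits-through-x r∈@(r~x , r~y) {u} {f} r~u u~f f≢r r≁f u≁x =
        c4 u~v v~x (~-sym xₑ~x) (~-sym u~xₑ) u≢x u≁x (proj₁ (avoids xₑ∈E) ∘ sym) (v≁ xₑ∈E)
        where
        covers : ∀ {s t} → r ~ s → r ~ t → s ~ t → ¬ u ~ s → ¬ u ~ t → ⊥
        covers = boundary-covers r~u u~f f≢r r≁f
        u~v = stable λ u≁v → covers (~-sym v~r) r~x v~x u≁v u≁x
        u~xₑ = stable λ u≁xₑ → covers r~x (complete D v~r r∈ xₑ∈E) (~-sym xₑ~x) u≁x u≁xₑ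
        -- If `u` were `x`, it would see neither end of the edge between `y` and `yₑ`.
        u≢x : u ≢ x
        u≢x refl = covers r~y (complete D v~r r∈ yₑ∈E) (~-sym yₑ~y)
          x≁y (λ x~yₑ → not-both yₑ∈E (~-sym x~yₑ) yₑ~y)

    triangle-free : ∀ {a b c} → a ~ b → b ~ c → c ~ a → ⊥
    triangle-free {a} {b} {c} a~b b~c c~a = detour a λ D → wheel D (hub D a~b (~-sym c~a) b~c)
      where
      wheel : ∀ {x y E} → (D : Detour G a x y E) → ∃[ r ] a ~ r × r ~ x × r ~ y → ⊥
      wheel {x} {y} D (r , a~r , r~x , r~y) =
        hub-spreads (r ~_) (r~x , r~y) r~x id step
        where
        open DetourProperties D
        -- If `w` were outside N(r), then `u` would see both `x` and `y` and lie in `Common`.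
        step : ∀ {u w} → r ~ u → ¬ Common u → u ~ w → ¬ Common w → ¬ ¬ r ~ w
        step {u} {w} r~u u∉ u~w w∉ r≁w =
          exits-through-x D a~r (r~x , r~y) r~u u~w w≢r r≁w λ u~x →
          exits-through-x (detour-swap D) a~r (r~y , r~x) r~u u~w w≢r r≁w λ u~y →
          u∉ (u~x , u~y)
          where
          w≢r : w ≢ r
          w≢r refl = w∉ (r~x , r~y)

  -- The bull-free case

  module BullCase (bull-free : Bull-Free G) where

    -- Edges of N(r) leaving the neighbourhood of an outside vertex f dominate N(r).
    boundary-dominates : ∀ {r f a s c} → ¬ r ~ f → r ~ a → a ~ f → r ~ s → s ~ a → ¬ s ~ f →
      r ~ c → ¬ c ~ a → ¬ c ~ s → ⊥
    boundary-dominates r≁f r~a a~f r~s s~a s≁f r~c c≁a c≁s =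
      bull-free (~-sym r~a) r~s s~a a~f r~c (≁-sym r≁f) (≁-sym s≁f) c≁a c≁s
        λ f~c → c4 (~-sym a~f) (~-sym r~a) r~c (~-sym f~c)
          (differ r~s (≁-sym s≁f)) (≁-sym r≁f) (differ (~-sym s~a) c≁s ∘ sym) (≁-sym c≁a)

    module _ {v x y E} (D : Detour G v x y E) {r} (v~r : v ~ r) (r~x : r ~ x)
      (r~yₑ : r ~ Detour.yₑ D) {f} (r≁f : ¬ r ~ f) where
      open DetourProperties D

      -- In N(r) the vertex `yₑ` sees neither `v` nor `x`. So by `boundary-dominates` `f` cannot see
      -- exactly one of `v` and `x`, which gives this and `end-exit`.
      centre-exit : v ~ f → x ~ f
      centre-exit v~f = stable λ x≁f → boundary-dominates r≁f (~-sym v~r) v~f r~x (~-sym v~x) x≁f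
        r~yₑ (≁v yₑ∈E) (λ yₑ~x → not-both yₑ∈E yₑ~x yₑ~y)

      end-exit : x ~ f → v ~ f
      end-exit x~f = stable λ v≁f → boundary-dominates r≁f r~x x~f (~-sym v~r) v~x v≁f
        r~yₑ (λ yₑ~x → not-both yₑ∈E yₑ~x yₑ~y) (≁v yₑ∈E)

    module _ {v x y E} (D : Detour G v x y E) {r} (v~r : v ~ r) (r~x : r ~ x) (r~y : r ~ y)
      (r~xₑ : r ~ Detour.xₑ D) (r~yₑ : r ~ Detour.yₑ D) where
      open DetourProperties D

      -- Adjacency to `f` passes from `x` to `v` and on to `y`, closing the 4-cycle `r`, `x`, `f`,
      -- `y`.
      end-interior : ∀ {f} → f ≢ r → ¬ r ~ f → ¬ x ~ f
      end-interior f≢r r≁f x~f = c4 r~x x~f (~-sym y~f) (~-sym r~y) (f≢r ∘ sym) r≁f x≢y x≁y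
        where
        v~f = end-exit D v~r r~x r~yₑ r≁f x~f
        y~f = centre-exit (detour-swap D) v~r r~y r~xₑ r≁f v~f

    -- Outside the clique Common no walk leaves N(r), so r would be universal.
    no-wheel : ∀ {v x y E} (D : Detour G v x y E) {r} → v ~ r → r ~ x → r ~ y →
      r ~ Detour.xₑ D → r ~ Detour.yₑ D → ⊥
    no-wheel {v} {x} {y} D {r} v~r r~x r~y r~xₑ r~yₑ =
      hub-spreads I (r~x , r~y) (r~x , x-int) proj₁ step
      where
      open DetourProperties D
      -- The invariant adds to adjacency with `r` that `u` has no neighbour outside N[r], so the
      -- next vertex of a walk stays in N(r).
      I : V G → Set
      I u = r ~ u × (∀ {f} → f ≢ r → ¬ r ~ f → ¬ u ~ f)
      x-int : ∀ {f} → f ≢ r → ¬ r ~ f → ¬ x ~ f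
      x-int = end-interior D v~r r~x r~y r~xₑ r~yₑ
      y-int : ∀ {f} → f ≢ r → ¬ r ~ f → ¬ y ~ f
      y-int = end-interior (detour-swap D) v~r r~y r~x r~yₑ r~xₑ
      module _ {w f} (w∉ : ¬ Common w) (f≢r : f ≢ r) (r≁f : ¬ r ~ f) (r~w : r ~ w) (w~f : w ~ f) where
        -- If `w` saw `x`, the edge between them would dominate N(r). As `y` misses `x`, it would
        -- see `w`, putting `w` in `Common`.
        w≁x : ¬ w ~ x
        w≁x w~x = w∉ (w~x , stable λ w≁y →
          boundary-dominates r≁f r~w w~f r~x (~-sym w~x) (x-int f≢r r≁f) r~y (≁-sym w≁y) (≁-sym x≁y))
        w≁y : ¬ w ~ y
        w≁y w~y = w∉ ((stable λ w≁x →
          boundary-dominates r≁f r~w w~f r~y (~-sym w~y) (y-int f≢r r≁f) r~x (≁-sym w≁x) x≁y) , w~y)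
      step : ∀ {u w} → I u → ¬ Common u → u ~ w → ¬ Common w → ¬ ¬ I w
      step {u} {w} (r~u , u-int) u∉ u~w w∉ w∉I = w∉I (r~w , w-int)
        where
        r~w : r ~ w
        r~w = stable λ r≁w → u-int (λ { refl → w∉ (r~x , r~y) }) r≁w u~w
        w-int : ∀ {f} → f ≢ r → ¬ r ~ f → ¬ w ~ f
        -- The edge between `w` and `u` dominates N(r), and `w` misses both `x` and `y`; so `u` sees
        -- both.
        w-int f≢r r≁f w~f = u∉ (u~ r~x (w≁x w∉ f≢r r≁f r~w w~f) , u~ r~y (w≁y w∉ f≢r r≁f r~w w~f))
          where
          u~ : ∀ {c} → r ~ c → ¬ w ~ c → u ~ c
          u~ r~c w≁c = stable λ u≁c → boundary-dominates r≁f r~w w~f r~u u~w (u-int f≢r r≁f)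
            r~c (≁-sym w≁c) (≁-sym u≁c)

    module _ {v x y E} (D : Detour G v x y E) {r} (v~r : v ~ r) (r~x : r ~ x) (r~y : r ~ y) where
      open DetourProperties D

      -- Let `F` be the component of `e` in E ∩ N(x). Bulls on `x` and two adjacent vertices of `F`,
      -- with pendant `v` at `x`, show that a vertex of `E` outside N(x) seen by one vertex of `F`
      -- is seen by `e`. If there is none, `F` exhausts `E` and `yₑ` sees both ends.
      leaves-N[x] : ∀ {e} → E e → e ~ x → ¬ (∀ {g} → E g → g ~ e → g ~ x)
      leaves-N[x] {e} e∈E e~x stays = not-both yₑ∈E (proj₂ (proj₁ yₑ∈F)) yₑ~y
        where
        F = Component G (λ u → E u × u ~ x) e
        e∈F : F e
        e∈F = (e∈E , e~x) , ε
        absorb : ∀ {w} → E w → ¬ w ~ x → ∀ {d d′} → F d → F d′ → d ~ d′ → d ~ w → d′ ~ w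
        absorb w∈E w≁x ((d∈E , d~x) , _) ((d′∈E , d′~x) , _) d~d′ d~w = stable λ d′≁w →
          bull-free d~x (~-sym d′~x) (~-sym d~d′) d~w (~-sym v~x)
            w≁x (≁-sym d′≁w) (v≁ d∈E) (v≁ d′∈E) (≁v w∈E)
        step : ∀ {u w} → E u → E w → u ~ w → F u → F w
        step {u} {w} _ w∈E u~w u∈F = component-step G u∈F u~w (w∈E , stable λ w≁x →
          w≁x (stays w∈E (~-sym (component-connected G (_~ w) (absorb w∈E w≁x) u∈F e∈F u~w))))
        yₑ∈F : F yₑ
        yₑ∈F = connected F step e∈E yₑ∈E e∈F

      y-off : ∀ {d f} → E d → r ~ d → ¬ d ~ y → f ≢ r → ¬ f ~ r → d ~ f → ¬ f ~ y
      y-off d∈E r~d d≁y f≢r f≁r d~f f~y = c4 (~-sym d~f) (~-sym r~d) r~y (~-sym f~y) f≢r f≁r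
        (differ (~-sym v~y) (≁v d∈E)) d≁y

      module _ {e} (e∈E : E e) (e~x : e ~ x) (r~e : r ~ e) where

        -- Otherwise the triangle `e`, `r`, `x` with pendants `g` at `e` and `y` at `r` is a bull.
        keeps-contact : ∀ {g} → E g → g ~ e → ¬ g ~ x → r ~ g
        keeps-contact {g} g∈E g~e g≁x = stable λ r≁g →
          bull-free (~-sym r~e) r~x (~-sym e~x) (~-sym g~e) r~y (≁-sym r≁g) g≁x
            (≁-sym e≁y) (≁-sym x≁y)
            (y-off e∈E r~e e≁y (differ r~x g≁x) (≁-sym r≁g) (~-sym g~e))
          where e≁y = not-both e∈E e~x

        -- If no neighbour of `r` in `E` saw `y`, the component `F` of `e` in E ∩ N(r) would fill
        -- `E` and contain `yₑ`, which does see `y`.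
        reaches-y : ∀ {g} → E g → g ~ e → ¬ g ~ x → ¬ (∀ {d} → E d → r ~ d → ¬ d ~ y)
        reaches-y {g} g∈E g~e g≁x none = none yₑ∈E (proj₂ (proj₁ yₑ∈F)) yₑ~y
          where
          F = Component G (λ u → E u × r ~ u) e
          e∈F : F e
          e∈F = (e∈E , r~e) , ε
          g∈F : F g
          g∈F = component-step G e∈F (~-sym g~e) (g∈E , keeps-contact g∈E g~e g≁x)
          module _ {f} (f∈E : E f) (r≁f : ¬ r ~ f) where
            f≢r : f ≢ r
            f≢r = differ (~-sym v~r) (≁v f∈E)
            absorb : ∀ {d d′} → F d → F d′ → d ~ d′ → d ~ f → d′ ~ f
            absorb ((d∈E , r~d) , _) ((d′∈E , r~d′) , _) d~d′ d~f = stable λ d′≁f →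
              bull-free (~-sym r~d) r~d′ (~-sym d~d′) d~f r~y (≁-sym r≁f) (≁-sym d′≁f)
                (≁-sym (none d∈E r~d)) (≁-sym (none d′∈E r~d′))
                (y-off d∈E r~d (none d∈E r~d) f≢r (≁-sym r≁f) d~f)
            -- Adjacency to `f` spreads over `F` to `e` and `g`, and a bull on `e`, `r`, `x` extends
            -- it to `x`. Then `f`, `x`, `r`, `g` is an induced 4-cycle.
            not-adjacent : ∀ {u} → F u → ¬ u ~ f
            not-adjacent u∈F u~f = c4 (~-sym x~f) (~-sym r~x) (proj₂ (proj₁ g∈F)) g~f
              f≢r (≁-sym r≁f) (differ (~-sym v~x) (≁v g∈E) ∘ sym) (≁-sym g≁x)
              where
              e~f = component-connected G (_~ f) absorb u∈F e∈F u~f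
              g~f = component-connected G (_~ f) absorb u∈F g∈F u~f
              x~f : x ~ f
              x~f = stable λ x≁f → bull-free (~-sym r~e) r~x (~-sym e~x) e~f r~y
                (≁-sym r≁f) (≁-sym x≁f) (≁-sym (none e∈E r~e)) (≁-sym x≁y)
                (y-off e∈E r~e (none e∈E r~e) f≢r (≁-sym r≁f) e~f)
          step : ∀ {u w} → E u → E w → u ~ w → F u → F w
          step u∈E w∈E u~w u∈F = component-step G u∈F u~w
            (w∈E , stable λ r≁w → not-adjacent w∈E r≁w u∈F u~w)
          yₑ∈F : F yₑ
          yₑ∈F = connected F step e∈E yₑ∈E e∈F

        -- The vertex `e` has a neighbour `g` in `E` outside N(x), hence `r` has a neighbour `d` in
        -- `E` that sees `y`. With `e` and `d` as contacts of the detour, `no-wheel` applies.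
        off-detour : ⊥
        off-detour = leaves-N[x] e∈E e~x λ {g} g∈E g~e → stable λ g≁x →
          reaches-y g∈E g~e g≁x λ {d} d∈E r~d d~y →
          no-wheel (record { connected = connected ; avoids = avoids
            ; v~x = v~x ; v~y = v~y ; x≢y = x≢y ; x≁y = x≁y
            ; xₑ∈E = e∈E ; yₑ∈E = d∈E ; xₑ~x = e~x ; yₑ~y = d~y })
            v~r r~x r~y r~e r~d

    -- Otherwise the triangle `u`, `y`, `u′` with pendants `w` at `u` and `q` at `y` is a bull,
    -- where an edge from `w` to `q` would give the 4-cycle `w`, `q`, `y`, `u`.
    transfer : ∀ {u u′ y q w} → u ~ u′ → u ~ y → u′ ~ y → q ~ y → ¬ u ~ q → ¬ u′ ~ q →
      u ~ w → ¬ u′ ~ w → w ~ y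
    transfer u~u′ u~y u′~y q~y u≁q u′≁q u~w u′≁w = stable λ w≁y →
      bull-free u~y (~-sym u′~y) (~-sym u~u′) u~w (~-sym q~y)
        w≁y (≁-sym u′≁w) (≁-sym u≁q) (≁-sym u′≁q)
        λ w~q → c4 w~q q~y (~-sym u~y) u~w
          (differ (~-sym u′~y) (≁-sym u′≁w)) w≁y (differ u~u′ (≁-sym u′≁q)) (≁-sym u≁q)

    -- By `off-detour`, `r` sees neither `xₑ` nor `yₑ`, and `v` does not either. A vertex telling
    -- `r` and `v` apart is then adjacent to `x` and to `y` by `transfer`, so it lies in the clique
    -- `Common` with both.
    common⇒twins : ∀ {v x y E} → Detour G v x y E → ∀ {r} → r ~ x → r ~ y → Twins G r v
    common⇒twins {v} {x} {y} D {r} r~x r~y with r ≟ v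
    ... | yes refl = λ _ → id , id
    ... | no r≢v = λ w →
        closed-⊆ (~-sym v~r) (r~x , r~y) (v~x , v~y) r≁xₑ r≁yₑ (v≁ xₑ∈E) (v≁ yₑ∈E)
      , closed-⊆ v~r (v~x , v~y) (r~x , r~y) (v≁ xₑ∈E) (v≁ yₑ∈E) r≁xₑ r≁yₑ
      where
      open DetourProperties D
      v~r : v ~ r
      v~r = Common-clique (v~x , v~y) (r~x , r~y) (r≢v ∘ sym)
      r≁xₑ : ¬ r ~ xₑ
      r≁xₑ = off-detour D v~r r~x r~y xₑ∈E xₑ~x
      r≁yₑ : ¬ r ~ yₑ
      r≁yₑ = off-detour (detour-swap D) v~r r~y r~x yₑ∈E yₑ~y
      closed-⊆ : ∀ {u u′} → u ~ u′ → Common u → Common u′ →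
        ¬ u ~ xₑ → ¬ u ~ yₑ → ¬ u′ ~ xₑ → ¬ u′ ~ yₑ → ∀ {w} → Closed G u w → Closed G u′ w
      closed-⊆ u~u′ _ _ _ _ _ _ (inj₁ refl) = inj₂ (~-sym u~u′)
      closed-⊆ {u} {u′} u~u′ (u~x , u~y) u′∈@(u′~x , u′~y) u≁xₑ u≁yₑ u′≁xₑ u′≁yₑ {w} (inj₂ u~w) =
        decidable-stable (closed? G u′ w) λ w∉ → w∉ (inj₂ (Common-clique u′∈
          ( transfer u~u′ u~x u′~x xₑ~x u≁xₑ u′≁xₑ u~w (w∉ ∘ inj₂)
          , transfer u~u′ u~y u′~y yₑ~y u≁yₑ u′≁yₑ u~w (w∉ ∘ inj₂)) (w∉ ∘ inj₁ ∘ sym)))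

    NonTwinNeighbour : V G → V G → Set
    NonTwinNeighbour v z = v ~ z × ¬ Twins G z v

    -- Every vertex reached from x within the component can replace x as an end of the detour.
    ends-disconnected : ∀ {v x y E} → Detour G v x y E →
      ∀ {d} → ¬ (Component G (NonTwinNeighbour v) d x × Component G (NonTwinNeighbour v) d y)
    ends-disconnected {v} {x} {y} {E} D (x∈C , y∈C) =
      proj₁ (component-connected G Q step x∈C y∈C (x≢y , x≁y , xₑ , xₑ∈E , xₑ~x)) refl
      where
      open DetourProperties D
      Q : V G → Set
      Q u = u ≢ y × ¬ u ~ y × ∃[ e ] E e × e ~ u
      step : ∀ {u w} → Component G (NonTwinNeighbour v) _ u → Component G (NonTwinNeighbour v) _ w →
        u ~ w → Q u → Q w
      step {u} {w} ((v~u , _) , _) ((v~w , w-nontwin) , _) u~w (u≢y , u≁y , e , e∈E , e~u) =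
        (λ { refl → u≁y u~w }) , w≁y , e , e∈E , e~w
        where
        D′ : Detour G v u y E
        D′ = record { connected = connected ; avoids = avoids
          ; v~x = v~u ; v~y = v~y ; x≢y = u≢y ; x≁y = u≁y
          ; xₑ∈E = e∈E ; yₑ∈E = yₑ∈E ; xₑ~x = e~u ; yₑ~y = yₑ~y }
        -- A common neighbour of the ends `u` and `y` of `D′` would be a twin of `v`.
        w≁y : ¬ w ~ y
        w≁y w~y = w-nontwin (common⇒twins D′ (~-sym u~w) w~y)
        -- Otherwise the triangle `v`, `u`, `w` with pendants `y` at `v` and `e` at `u` is a bull.
        e~w : e ~ w
        e~w = stable λ e≁w → bull-free v~u u~w (~-sym v~w) v~y (~-sym e~u)
          (≁-sym u≁y) (≁-sym w≁y) (≁v e∈E) e≁w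
          (λ y~e → DetourProperties.not-both D′ e∈E e~u (~-sym y~e))

    module _ {v b z} (b∈ : NonTwinNeighbour v b) (z∈ : NonTwinNeighbour v z)
      (z∉C : ¬ Component G (NonTwinNeighbour v) b z) where

      private
        C : V G → Set
        C = Component G (NonTwinNeighbour v) b

        z-off : ∀ {d} → C d → ¬ z ~ d
        z-off d∈C z~d = z∉C (component-step G d∈C (~-sym z~d) z∈)

        C-connected : ConnectedSet G C
        C-connected = component-connected G

      -- If `w` misses `v`, a bull on `v` and two adjacent vertices of `C`, with pendant `z` at `v`,
      -- spreads adjacency to `w` over `C`. If `w` sees `v`, it is a twin of `v`, for otherwise `C`
      -- would absorb it; so it sees all of `C`.
      component-module : ∀ {w} → ¬ C w → ∀ {d d′} → C d → C d′ → d ~ w → d′ ~ w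
      component-module {w} w∉C {d} {d′} d∈C d′∈C d~w with v ≟ w | v ~? w
      ... | yes refl | _ = ~-sym (proj₁ (proj₁ d′∈C))
      ... | no v≢w | no v≁w = C-connected (_~ w) absorb d∈C d′∈C d~w
        where
        absorb : ∀ {d d′} → C d → C d′ → d ~ d′ → d ~ w → d′ ~ w
        absorb d∈C@((v~d , _) , _) d′∈C@((v~d′ , _) , _) d~d′ d~w = stable λ d′≁w →
          bull-free (~-sym v~d) v~d′ (~-sym d~d′) d~w (proj₁ z∈) (≁-sym v≁w) (≁-sym d′≁w)
            (z-off d∈C) (z-off d′∈C)
            λ w~z → c4 (~-sym d~w) (~-sym v~d) (proj₁ z∈) (~-sym w~z) (v≢w ∘ sym) (≁-sym v≁w)
              (λ { refl → z∉C d∈C }) (≁-sym (z-off d∈C))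
      ... | no v≢w | yes v~w with twins? G w v
      ...   | no w-nontwin = contradiction (component-step G d∈C d~w (v~w , w-nontwin)) w∉C
      ...   | yes w-twin with proj₂ (w-twin d′) (inj₂ (proj₁ (proj₁ d′∈C)))
      ...     | inj₁ refl = contradiction d′∈C w∉C
      ...     | inj₂ w~d′ = ~-sym w~d′

      -- The neighbourhood of a non-clique module is a clique separating it from z.
      component-clique : Clique G C
      component-clique {d} {d′} d∈C d′∈C d≢d′ = stable λ d≁d′ →
        unseparated K C (K-clique d≁d′) step (λ (d∉C , _) → d∉C d∈C)
          (λ (_ , d~z) → z-off d∈C (~-sym d~z)) d∈C z∉C
        where
        K : V G → Set
        K w = ¬ C w × d ~ w
        -- As `C` is a module, `K` consists of common neighbours of the non-adjacent `d` and `d′`.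
        K-clique : ¬ d ~ d′ → Clique G K
        K-clique d≁d′ (u∉C , d~u) (w∉C , d~w) = common-clique d≢d′ d≁d′
          (~-sym d~u , ~-sym (component-module u∉C d∈C d′∈C d~u))
          (~-sym d~w , ~-sym (component-module w∉C d∈C d′∈C d~w))
        step : ∀ {u w} → C u → ¬ K u → u ~ w → ¬ K w → ¬ ¬ C w
        step u∈C _ u~w w∉K w∉C = w∉K (w∉C , component-module w∉C u∈C d∈C u~w)

      -- Vertices of a clique that is a module agree both inside and outside it.
      component-twins : ∀ {c} → C c → Twins G b c
      component-twins {c} c∈C w = closed-⊆ b∈C c∈C , closed-⊆ c∈C b∈C
        where
        b∈C : C b
        b∈C = b∈ , ε
        closed-⊆ : ∀ {d d′} → C d → C d′ → Closed G d w → Closed G d′ w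
        closed-⊆ {d} {d′} d∈C d′∈C w∈ = decidable-stable (closed? G d′ w) λ w∉ → beyond w∈ w∉
          (λ w∈C → w∉ (inj₂ (component-clique d′∈C w∈C (w∉ ∘ inj₁ ∘ sym))))
          where
          beyond : Closed G d w → ¬ Closed G d′ w → ¬ ¬ C w
          beyond (inj₁ refl) _ w∉C = w∉C d∈C
          beyond (inj₂ d~w) w∉ w∉C = w∉ (inj₂ (component-module w∉C d∈C d′∈C d~w))

    -- A non-twin neighbour of `a` outside the component of `b` would make `b` and `c` twins by
    -- `component-twins`. So both ends of a detour through `a` lie in that component, against
    -- `ends-disconnected`.
    nontwin-triangle-free : ∀ {a b c} → a ~ b → b ~ c → c ~ a →
      ¬ Twins G b a → ¬ Twins G c a → ¬ Twins G b c → ⊥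
    nontwin-triangle-free {a} {b} {c} a~b b~c c~a b-a c-a b-c = detour a split
      where
      b∈ : NonTwinNeighbour a b
      b∈ = a~b , b-a
      in-component : ∀ {z} → NonTwinNeighbour a z → ¬ ¬ Component G (NonTwinNeighbour a) b z
      in-component z∈ z∉C =
        b-c (component-twins b∈ z∈ z∉C (component-step G (b∈ , ε) b~c (~-sym c~a , c-a)))
      nontwin : ∀ {x y} → x ≢ y → ¬ x ~ y → a ~ y → ¬ Twins G x a
      nontwin x≢y x≁y a~y twins with proj₂ (twins _) (inj₂ a~y)
      ... | inj₁ y≡x = x≢y (sym y≡x)
      ... | inj₂ x~y = x≁y x~y
      split : ∀ {x y E} → Detour G a x y E → ⊥
      split D =
        in-component (v~x , nontwin x≢y x≁y v~y) λ x∈C →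
        in-component (v~y , nontwin (x≢y ∘ sym) (≁-sym x≁y) v~x) λ y∈C →
        ends-disconnected D (x∈C , y∈C)
        where open Detour D

-- Girth

module Copy (H G : Graph) (induced : ∃[ S ] G [ S ] ≅ H) where
  open Graph G using (_~_)

  private
    e = induced⇒embedding {H} {G} induced

  copy : V H → V G
  copy = proj₁ e

  copy-edge : ∀ i j → {True (Graph._~?_ H i j)} → copy i ~ copy j
  copy-edge i j {edge} = Equivalence.from (proj₂ (proj₂ e) i j) (toWitness edge)

  copy-nonedge : ∀ i j → {False (Graph._~?_ H i j)} → ¬ copy i ~ copy j
  copy-nonedge i j {nonedge} = toWitnessFalse nonedge ∘ Equivalence.to (proj₂ (proj₂ e) i j)

  copy-distinct : ∀ i j → {False (i ≟ j)} → copy i ≢ copy j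
  copy-distinct i j {i≢j} = toWitnessFalse i≢j ∘ proj₁ (proj₂ e)

module _ (G : Graph) where
  open Graph G hiding (V; order)

  C₄-free⁻ : C₄-Free G → ¬ (∃[ S ] G [ S ] ≅ C₄)
  C₄-free⁻ free S = free
    (copy-edge (# 0) (# 1)) (copy-edge (# 1) (# 2))
    (copy-edge (# 2) (# 3)) (copy-edge (# 3) (# 0))
    (copy-distinct (# 0) (# 2)) (copy-nonedge (# 0) (# 2))
    (copy-distinct (# 1) (# 3)) (copy-nonedge (# 1) (# 3))
    where open Copy C₄ G S

  bull-free⁻ : Bull-Free G → ¬ (∃[ S ] G [ S ] ≅ bull)
  bull-free⁻ free S = free
    (copy-edge (# 0) (# 1)) (copy-edge (# 1) (# 2)) (copy-edge (# 2) (# 0))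
    (copy-edge (# 0) (# 3)) (copy-edge (# 1) (# 4))
    (copy-nonedge (# 3) (# 1)) (copy-nonedge (# 3) (# 2)) (copy-nonedge (# 4) (# 0))
    (copy-nonedge (# 4) (# 2)) (copy-nonedge (# 3) (# 4))
    where open Copy bull G S

  Triangle-Free : Set
  Triangle-Free = ∀ {a b c} → a ~ b → b ~ c → c ~ a → ⊥

  4-Cycle-Free : Set
  4-Cycle-Free = ∀ {a b c d} → a ~ b → b ~ c → c ~ d → d ~ a → a ≢ c → b ≢ d → ⊥

  triangle-free⇒hammer-free : Triangle-Free → ¬ (∃[ S ] G [ S ] ≅ hammer)
  triangle-free⇒hammer-free free S =
    free (copy-edge (# 0) (# 1)) (copy-edge (# 1) (# 2)) (copy-edge (# 2) (# 0))
    where open Copy hammer G S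

  4-cycle-free⁺ : C₄-Free G → Triangle-Free → 4-Cycle-Free
  4-cycle-free⁺ c4 tri {a} {b} {c} {d} a~b b~c c~d d~a a≢c b≢d with a ~? c | b ~? d
  ... | yes a~c | _       = tri a~b b~c (~-sym a~c)
  ... | no _    | yes b~d = tri a~b b~d d~a
  ... | no a≁c  | no b≁d  = c4 a~b b~c c~d d~a a≢c a≁c b≢d b≁d

  4-cycle-free⁻ : 4-Cycle-Free → C₄-Free G
  4-cycle-free⁻ quad a~b b~c c~d d~a a≢c _ b≢d _ = quad a~b b~c c~d d~a a≢c b≢d

cyclicNext-unique : ∀ {ℓ} {i j k : Fin ℓ} → CyclicNext i j → CyclicNext i k → j ≡ k
cyclicNext-unique (inj₁ j≡) (inj₁ k≡) = toℕ-injective (trans j≡ (sym k≡))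
cyclicNext-unique {j = j} (inj₁ j≡) (inj₂ (ℓ≡ , _)) = contradiction (toℕ<n j) (<-irrefl (trans j≡ ℓ≡))
cyclicNext-unique {k = k} (inj₂ (ℓ≡ , _)) (inj₁ k≡) = contradiction (toℕ<n k) (<-irrefl (trans k≡ ℓ≡))
cyclicNext-unique (inj₂ (_ , j≡)) (inj₂ (_ , k≡)) = toℕ-injective (trans j≡ (sym k≡))

module _ (G : Graph) where
  open Graph G hiding (V; order)

  -- Cyclic successors are unique, so one adjacent successor per position suffices.
  cycle : ∀ {ℓ} (vs : Vec (V G) ℓ) → 3 ≤ ℓ → Unique vs →
    (∀ i → ∃[ j ] CyclicNext i j × lookup vs i ~ lookup vs j) → Cycle G ℓ
  cycle vs 3≤ℓ unique next = record
    { 3≤ℓ = 3≤ℓ ; vertex = lookup vs ; distinct = lookup-injective unique _ _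
    ; adjacent = λ i j i→j → let k , i→k , i~k = next i in
        subst (λ v → lookup vs i ~ lookup vs v) (cyclicNext-unique i→k i→j) i~k }

  private
    ~⇒≢ : ∀ {u w} → u ~ w → u ≢ w
    ~⇒≢ u~w u≡w = ~-irr u≡w u~w

  triangle : ∀ {a b c} → a ~ b → b ~ c → c ~ a → Cycle G 3
  triangle {a} {b} {c} a~b b~c c~a = cycle (a ∷ b ∷ c ∷ []) (s≤s (s≤s (s≤s z≤n)))
    ((~⇒≢ a~b VecAll.∷ ~⇒≢ (~-sym c~a) VecAll.∷ VecAll.[]) AllPairs.∷
     (~⇒≢ b~c VecAll.∷ VecAll.[]) AllPairs.∷ VecAll.[] AllPairs.∷ AllPairs.[])
    λ { zero → # 1 , inj₁ refl , a~b
      ; (suc zero) → # 2 , inj₁ refl , b~c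
      ; (suc (suc zero)) → # 0 , inj₂ (refl , refl) , c~a }

  4-cycle : ∀ {a b c d} → a ~ b → b ~ c → c ~ d → d ~ a → a ≢ c → b ≢ d → Cycle G 4
  4-cycle {a} {b} {c} {d} a~b b~c c~d d~a a≢c b≢d =
    cycle (a ∷ b ∷ c ∷ d ∷ []) (s≤s (s≤s (s≤s z≤n)))
    ((~⇒≢ a~b VecAll.∷ a≢c VecAll.∷ ~⇒≢ (~-sym d~a) VecAll.∷ VecAll.[]) AllPairs.∷
     (~⇒≢ b~c VecAll.∷ b≢d VecAll.∷ VecAll.[]) AllPairs.∷
     (~⇒≢ c~d VecAll.∷ VecAll.[]) AllPairs.∷ VecAll.[] AllPairs.∷ AllPairs.[])
    λ { zero → # 1 , inj₁ refl , a~b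
      ; (suc zero) → # 2 , inj₁ refl , b~c
      ; (suc (suc zero)) → # 3 , inj₁ refl , c~d
      ; (suc (suc (suc zero))) → # 0 , inj₂ (refl , refl) , d~a }

  cycle₃⇒triangle : Triangle-Free G → ¬ Cycle G 3
  cycle₃⇒triangle tri C =
    tri (adjacent (# 0) (# 1) (inj₁ refl)) (adjacent (# 1) (# 2) (inj₁ refl))
        (adjacent (# 2) (# 0) (inj₂ (refl , refl)))
    where open Cycle C

  triangle-free⇒4≤ : Triangle-Free G → ∀ m → Cycle G m → 4 ≤ m
  triangle-free⇒4≤ tri m C with Cycle.3≤ℓ C
  ... | s≤s (s≤s (s≤s (z≤n {zero})))  = contradiction C (cycle₃⇒triangle tri)
  ... | s≤s (s≤s (s≤s (z≤n {suc _}))) = s≤s (s≤s (s≤s (s≤s z≤n)))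

  girth≥5⁺ : Triangle-Free G → 4-Cycle-Free G → GirthAtLeast 5 G
  girth≥5⁺ tri quad g (C , _) with triangle-free⇒4≤ tri g C
  ... | s≤s (s≤s (s≤s (s≤s (z≤n {suc _})))) = s≤s (s≤s (s≤s (s≤s (s≤s z≤n))))
  ... | s≤s (s≤s (s≤s (s≤s (z≤n {zero}))))  = ⊥-elim (quad
    (adjacent (# 0) (# 1) (inj₁ refl)) (adjacent (# 1) (# 2) (inj₁ refl))
    (adjacent (# 2) (# 3) (inj₁ refl)) (adjacent (# 3) (# 0) (inj₂ (refl , refl)))
    (λ eq → contradiction (distinct eq) λ ()) (λ eq → contradiction (distinct eq) λ ()))
    where open Cycle C

  girth≥5⇒triangle-free : GirthAtLeast 5 G → Triangle-Free G
  girth≥5⇒triangle-free girth≥5 a~b b~c c~a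
    with girth≥5 3 (triangle a~b b~c c~a , λ _ → Cycle.3≤ℓ)
  ... | s≤s (s≤s (s≤s ()))

  -- `HasGirth` asks for a shortest cycle; a 4-cycle is one because triangles are already excluded.
  girth≥5⇒4-cycle-free : GirthAtLeast 5 G → 4-Cycle-Free G
  girth≥5⇒4-cycle-free girth≥5 a~b b~c c~d d~a a≢c b≢d
    with girth≥5 4 (4-cycle a~b b~c c~d d~a a≢c b≢d ,
                    triangle-free⇒4≤ (girth≥5⇒triangle-free girth≥5))
  ... | s≤s (s≤s (s≤s (s≤s ())))

-- Clique blowups

module BlowupOf (G H : Graph) (blowup : IsCliqueBlowupOf G H) (girth≥5 : GirthAtLeast 5 H) where
  open Graph G hiding (V; order)
  open Graph H using () renaming (_~_ to _~ₕ_; ~-sym to ~ₕ-sym)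

  private
    k = proj₁ blowup
    iso = proj₁ (proj₂ blowup)
    respects = proj₂ (proj₂ blowup)
    open Inverse iso using (to; strictlyInverseʳ)

  base : V G → V H
  base = proj₁ ∘ to

  to-injective : Injective _≡_ _≡_ to
  to-injective {u} {w} eq =
    trans (sym (strictlyInverseʳ u)) (trans (cong (Inverse.from iso) eq) (strictlyInverseʳ w))

  same-base⇒adjacent : ∀ {u w} → base u ≡ base w → u ≢ w → u ~ w
  same-base⇒adjacent {u} {w} eq u≢w =
    Equivalence.from (respects u w) (inj₂ (eq , u≢w ∘ to-injective))

  same-base⇒twins : ∀ {u w z} → base u ≡ base w → u ~ z → z ≢ w → w ~ z
  same-base⇒twins {u} {w} {z} eq u~z z≢w with Equivalence.to (respects u z) u~z
  ... | inj₁ u~ₕz       = Equivalence.from (respects w z) (inj₁ (subst (_~ₕ base z) eq u~ₕz))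
  ... | inj₂ (eq′ , _) = same-base⇒adjacent (trans (sym eq) eq′) (z≢w ∘ sym)

  -- Vertices over the same base have the same closed neighbourhood. As `z` tells `u` and `w` apart,
  -- their edge must come from `H`.
  distinguished : ∀ {u w z} → u ~ w → u ~ z → ¬ w ~ z → z ≢ w → base u ~ₕ base w
  distinguished {u} {w} {z} u~w u~z w≁z z≢w with Equivalence.to (respects u w) u~w
  ... | inj₁ u~ₕw      = u~ₕw
  ... | inj₂ (eq , _) = contradiction (same-base⇒twins eq u~z z≢w) w≁z

  -- Each edge is distinguished by the other cycle neighbour of its first end, and non-adjacent
  -- vertices have different bases; so the 4-cycle projects to one in `H`.
  blowup-C₄-free : C₄-Free G
  blowup-C₄-free a~b b~c c~d d~a a≢c a≁c b≢d b≁d =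
    girth≥5⇒4-cycle-free H girth≥5
      (distinguished a~b (~-sym d~a) b≁d (b≢d ∘ sym))
      (distinguished b~c (~-sym a~b) (a≁c ∘ ~-sym) a≢c)
      (distinguished c~d (~-sym b~c) (b≁d ∘ ~-sym) b≢d)
      (distinguished d~a (~-sym c~d) a≁c (a≢c ∘ sym))
      (λ eq → a≁c (same-base⇒adjacent eq a≢c))
      (λ eq → b≁d (same-base⇒adjacent eq b≢d))

  -- The pendant vertices distinguish the edges of the triangle, which therefore projects to a
  -- triangle in `H`.
  blowup-bull-free : Bull-Free G
  blowup-bull-free a~b b~c c~a a~p b~q p≁b p≁c q≁a q≁c p≁q =
    girth≥5⇒triangle-free H girth≥5
      (distinguished a~b a~p (p≁b ∘ ~-sym) (separated-by G b~c p≁c))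
      (distinguished b~c b~q (q≁c ∘ ~-sym) (separated-by G c~a q≁a))
      (~ₕ-sym (distinguished (~-sym c~a) a~p (p≁c ∘ ~-sym) (separated-by G (~-sym b~c) p≁b)))

-- The quotient by twins

module TwinQuotient (G : Graph) (c4 : C₄-Free G)
  (nontwin-triangle-free : ∀ {a b c} → Graph._~_ G a b → Graph._~_ G b c → Graph._~_ G c a →
    ¬ Twins G b a → ¬ Twins G c a → ¬ Twins G b c → ⊥) where
  open Graph G hiding (V; order)
  open IsEquivalence (twins-equivalence G) using ()
    renaming (refl to twins-refl; sym to twins-sym; trans to twins-trans)

  private
    classification = classify (twins-equivalence G) (twins? G)
    d = proj₁ classification
    label : V G → Fin d
    label = proj₁ (proj₂ classification)
    surj = proj₁ (proj₂ (proj₂ classification))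
    classes = proj₂ (proj₂ (proj₂ classification))

  representative : Fin d → V G
  representative = proj₁ ∘ surj

  label-representative : ∀ i → label (representative i) ≡ i
  label-representative i = proj₂ (surj i) refl

  -- Adjacency is read off from one representative per class, so the quotient is an induced copy
  -- inside `G` and inherits its forbidden subgraphs.
  quotient : Graph
  quotient = record
    { order = d ; _~_ = _~_ on representative ; ~-sym = ~-sym
    ; ~-irr = λ { refl → ~-irr refl } ; _~?_ = λ i j → representative i ~? representative j }

  representative-injective : Injective _≡_ _≡_ representative
  representative-injective {i} {j} eq =
    trans (sym (label-representative i)) (trans (cong label eq) (label-representative j))

  adjacent-nontwins : ∀ {i j} → representative i ~ representative j →
    ¬ Twins G (representative i) (representative j)
  adjacent-nontwins {i} {j} i~j twins = ~-irr (cong representative i≡j) i~j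
    where
    i≡j : i ≡ j
    i≡j = trans (sym (label-representative i))
      (trans (Equivalence.from (classes _ _) twins) (label-representative j))

  quotient-triangle-free : Triangle-Free quotient
  quotient-triangle-free a~b b~c c~a = nontwin-triangle-free a~b b~c c~a
    (adjacent-nontwins (~-sym a~b)) (adjacent-nontwins c~a) (adjacent-nontwins b~c)

  quotient-C₄-free : C₄-Free quotient
  quotient-C₄-free a~b b~c c~d d~a a≢c a≁c b≢d b≁d =
    c4 a~b b~c c~d d~a (a≢c ∘ representative-injective) a≁c (b≢d ∘ representative-injective) b≁d

  quotient-girth≥5 : GirthAtLeast 5 quotient
  quotient-girth≥5 = girth≥5⁺ quotient quotient-triangle-free
    (4-cycle-free⁺ quotient quotient-C₄-free quotient-triangle-free)

  twins-adjacent : ∀ {u w} → Twins G u w → u ≢ w → u ~ w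
  twins-adjacent {u} {w} t u≢w with proj₁ (t u) (inj₁ refl)
  ... | inj₁ u≡w = contradiction u≡w u≢w
  ... | inj₂ w~u = ~-sym w~u

  -- The closed neighbourhood of `u′` contains `w`, and `w` differs from `u′` because it is not a
  -- twin of `u`.
  replace : ∀ {u u′ w} → Twins G u u′ → ¬ Twins G u w → u ~ w → u′ ~ w
  replace {w = w} t not-twins u~w with proj₁ (t w) (inj₂ u~w)
  ... | inj₁ refl = contradiction t not-twins
  ... | inj₂ u′~w = u′~w

  replace-both : ∀ {u u′ w w′} → Twins G u u′ → Twins G w w′ → ¬ Twins G u w → u ~ w → u′ ~ w′
  replace-both t s not-twins u~w = ~-sym (replace s
    (λ w-u′ → not-twins (twins-trans t (twins-sym w-u′))) (~-sym (replace t not-twins u~w)))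

  private
    class? : ∀ i v → Dec (label v ≡ i)
    class? i v = label v ≟ i

  size : Fin d → ℕ
  size i = ∣ subset (class? i) ∣

  position : ∀ v → ∃[ p ] element (subset (class? (label v))) p ≡ v
  position v = index (∈-subset⁺ (class? (label v)) refl)

  to : V G → Σ[ i ∈ Fin d ] Fin (size i)
  to v = label v , proj₁ (position v)

  from : Σ[ i ∈ Fin d ] Fin (size i) → V G
  from (i , p) = element (subset (class? i)) p

  from∘to : ∀ v → from (to v) ≡ v
  from∘to v = proj₂ (position v)

  to∘from : ∀ x → to (from x) ≡ x
  to∘from (i , p) = lemma p refl (∈-subset⁻ (class? i) (element-∈ (subset (class? i)) p))
    where
    -- The class `i` is kept general so that `label v ≡ i` can be matched with `refl`; afterwards
    -- both positions lie in the same class.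
    lemma : ∀ {i v} (p : Fin (size i)) → element (subset (class? i)) p ≡ v → label v ≡ i → to v ≡ (i , p)
    lemma {v = v} p eq refl = cong (label v ,_)
      (element-injective (subset (class? (label v))) (trans (proj₂ (position v)) (sym eq)))

  is-blowup : IsCliqueBlowupOf G quotient
  is-blowup = size , mk↔ₛ′ to from to∘from from∘to , λ x y → mk⇔ (split x y) (join x y)
    where
    represents : ∀ v → Twins G v (representative (label v))
    represents v = Equivalence.to (classes _ _) (sym (label-representative (label v)))
    split : ∀ x y → x ~ y → BlowupAdj quotient size (to x) (to y)
    split x y x~y with twins? G x y
    ... | yes t = inj₂ (Equivalence.from (classes x y) t , λ eq →
      ~-irr (trans (sym (from∘to x)) (trans (cong from eq) (from∘to y))) x~y)
    ... | no not-twins = inj₁ (replace-both (represents x) (represents y) not-twins x~y)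
    join : ∀ x y → BlowupAdj quotient size (to x) (to y) → x ~ y
    join x y (inj₁ x~y) = replace-both (twins-sym (represents x)) (twins-sym (represents y))
      (adjacent-nontwins {label x} {label y} x~y) x~y
    join x y (inj₂ (eq , to-x≢to-y)) =
      twins-adjacent (Equivalence.to (classes x y) eq) (to-x≢to-y ∘ cong to)

-- Assembly of the two equivalences

theorem1p5 : (G : Graph) →
    Connected G →
    ¬ (∃[ K ] IsCliqueCutset G K) →
    ¬ (∃[ v ] IsUniversal G v) →
    (((C₄ ∷ hammer ∷ []) -free) G ⇔ GirthAtLeast 5 G) ×
    (((C₄ ∷ bull ∷ []) -free) G ⇔ (∃[ H ] GirthAtLeast 5 H × IsCliqueBlowupOf G H))
theorem1p5 G connected no-cutset no-universal =
  mk⇔ hammer-free⇒girth≥5 girth≥5⇒hammer-free , mk⇔ bull-free⇒blowup blowup⇒bull-free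
  where
  unseparated : Unseparated G
  unseparated = no-cutset⇒unseparated G connected no-cutset
  hammer-free⇒girth≥5 : ((C₄ ∷ hammer ∷ []) -free) G → GirthAtLeast 5 G
  hammer-free⇒girth≥5 (no-C₄ ∷ no-hammer ∷ []) =
    girth≥5⁺ G tri (4-cycle-free⁺ G c4 tri)
    where
    c4 = C₄-free⁺ G no-C₄
    tri : Triangle-Free G
    tri = Theory.HammerCase.triangle-free G c4 unseparated no-universal (hammer-free⁺ G no-hammer)
  girth≥5⇒hammer-free : GirthAtLeast 5 G → ((C₄ ∷ hammer ∷ []) -free) G
  girth≥5⇒hammer-free girth≥5 =
    C₄-free⁻ G (4-cycle-free⁻ G (girth≥5⇒4-cycle-free G girth≥5)) ∷
    triangle-free⇒hammer-free G (girth≥5⇒triangle-free G girth≥5) ∷ []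
  bull-free⇒blowup : ((C₄ ∷ bull ∷ []) -free) G → ∃[ H ] GirthAtLeast 5 H × IsCliqueBlowupOf G H
  bull-free⇒blowup (no-C₄ ∷ no-bull ∷ []) = quotient , quotient-girth≥5 , is-blowup
    where
    c4 : C₄-Free G
    c4 = C₄-free⁺ G no-C₄
    open TwinQuotient G c4
      (Theory.BullCase.nontwin-triangle-free G c4 unseparated no-universal (bull-free⁺ G no-bull))
  blowup⇒bull-free : ∃[ H ] GirthAtLeast 5 H × IsCliqueBlowupOf G H → ((C₄ ∷ bull ∷ []) -free) G
  blowup⇒bull-free (H , girth≥5 , blowup) =
    C₄-free⁻ G blowup-C₄-free ∷ bull-free⁻ G blowup-bull-free ∷ []
    where open BlowupOf G H blowup girth≥5
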